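{- The amalgamation property fails for the variety of semilinear idempotent residuated lattices. It also fails for the variety of semiconic idempotent residuated lattices.
   Context: A residuated lattice is an algebra $(A,\wedge,\vee,\cdot,\backslash,/,1)$ such that $(A,\wedge,\vee)$ is a lattice, $(A,\cdot,1)$ is a monoid, and $y\le x\backslash z \iff x\cdot y\le z\iff x\le z/y$ for all $x,y,z$. It is idempotent if it satisfies $x\cdot x=x$, semilinear if it is a subdirect product of totally ordered residuated lattices, conic if every $a\in A$ satisfies $a\le 1$ or $1\le a$, and semiconic if it belongs to the variety generated by all conic residuated lattices. A class $\mathcal K$ of similar algebras has the amalgamation property if for all $\mathbf A,\mathbf B,\mathbf C\in\mathcal K$ and embeddings $f_B\colon\mathbf A\to\mathbf B$, $f_C\colon\mathbf A\to\mathbf C$ there are $\mathbf D\in\mathcal K$ and embeddings $g_B\colon\mathbf B\to\mathbf D$, $g_C\colon\mathbf C\to\mathbf D$ with $g_B\circ f_B=g_C\circ f_C$. -}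

module Defs where

open import Level using (Level; suc; _⊔_)
open import Algebra.Core using (Op₂)
open import Algebra.Structures using (IsMonoid)
open import Algebra.Bundles using (RawMonoid)
open import Algebra.Lattice.Structures using (IsLattice)
open import Algebra.Lattice.Bundles using (RawLattice)
open import Algebra.Morphism.Structures using (module MonoidMorphisms)
open import Algebra.Lattice.Morphism.Structures using (module LatticeMorphisms)
open import Data.Nat.Base using (ℕ)
open import Data.Product.Base using (Σ-syntax; ∃-syntax; _×_)
open import Data.Sum.Base using (_⊎_)
open import Function.Base using (_∘_)
open import Function.Bundles using (_⇔_)
open import Function.Definitions using (Injective; Surjective)
open import Relation.Binary.Core using (Rel)

-- As in the standard library's algebraic hierarchy, the carrier is a setoid and
-- equality of elements is _≈_.  The residual x\z is written x \\ z and z/y is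
-- written z // y.  Congruence of the two residuals is not a field, because it
-- follows from the residuation laws and antisymmetry.
record ResiduatedLattice c ℓ : Set (suc (c ⊔ ℓ)) where
  infix  4 _≈_ _≤_
  infixr 6 _∨_
  infixr 7 _∧_
  infixl 8 _∙_
  infixr 8 _\\_
  infixl 8 _//_
  field
    Carrier   : Set c
    _≈_       : Rel Carrier ℓ
    _∧_       : Op₂ Carrier
    _∨_       : Op₂ Carrier
    _∙_       : Op₂ Carrier
    _\\_      : Op₂ Carrier
    _//_      : Op₂ Carrier
    ε         : Carrier
    isLattice : IsLattice _≈_ _∨_ _∧_
    isMonoid  : IsMonoid _≈_ _∙_ ε

  -- The same order as in Algebra.Lattice.Properties.Lattice.
  _≤_ : Rel Carrier ℓ
  x ≤ y = x ≈ x ∧ y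

  field
    \\-residual : ∀ x y z → (y ≤ x \\ z) ⇔ (x ∙ y ≤ z)
    //-residual : ∀ x y z → (x ∙ y ≤ z) ⇔ (x ≤ z // y)

  rawLattice : RawLattice c ℓ
  rawLattice = record { _≈_ = _≈_ ; _∧_ = _∧_ ; _∨_ = _∨_ }

  rawMonoid : RawMonoid c ℓ
  rawMonoid = record { _≈_ = _≈_ ; _∙_ = _∙_ ; ε = ε }

open ResiduatedLattice using (Carrier)

module _ {a b ℓ₁ ℓ₂ : Level}
         (A : ResiduatedLattice a ℓ₁) (B : ResiduatedLattice b ℓ₂) where
  private
    module A = ResiduatedLattice A
    module B = ResiduatedLattice B
  open LatticeMorphisms A.rawLattice B.rawLattice using (IsLatticeHomomorphism)
  open MonoidMorphisms A.rawMonoid B.rawMonoid using (IsMonoidHomomorphism)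

  record IsHomomorphism (f : A.Carrier → B.Carrier) : Set (a ⊔ ℓ₁ ⊔ ℓ₂) where
    field
      isLatticeHomomorphism : IsLatticeHomomorphism f
      isMonoidHomomorphism  : IsMonoidHomomorphism f
      \\-homo               : ∀ x y → f (x A.\\ y) B.≈ (f x B.\\ f y)
      //-homo               : ∀ x y → f (x A.// y) B.≈ (f x B.// f y)

  record IsEmbedding (f : A.Carrier → B.Carrier) : Set (a ⊔ ℓ₁ ⊔ ℓ₂) where
    field
      isHomomorphism : IsHomomorphism f
      injective      : Injective A._≈_ B._≈_ f

module _ {c ℓ : Level} (A : ResiduatedLattice c ℓ) where
  open ResiduatedLattice A hiding (Carrier)

  Idempotent : Set (c ⊔ ℓ)
  Idempotent = ∀ x → x ∙ x ≈ x

  TotallyOrdered : Set (c ⊔ ℓ)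
  TotallyOrdered = ∀ x y → (x ≤ y) ⊎ (y ≤ x)

  Conic : Set (c ⊔ ℓ)
  Conic = ∀ x → (x ≤ ε) ⊎ (ε ≤ x)

-- A homomorphism from A into the direct product of the factors is a family of
-- homomorphisms proj i; it is injective iff the family is jointly injective,
-- and it is subdirect iff every proj i is surjective.  Pairs of distinct
-- elements of A can serve as indices, hence the universe of Index.
record IsSubdirectProductOf {c ℓ p : Level} (K : ResiduatedLattice c ℓ → Set p)
                            (A : ResiduatedLattice c ℓ) : Set (suc (c ⊔ ℓ) ⊔ p) where
  private module A = ResiduatedLattice A
  field
    Index  : Set (c ⊔ ℓ)
    factor : Index → ResiduatedLattice c ℓ
    inK    : ∀ i → K (factor i)
    proj   : ∀ i → A.Carrier → Carrier (factor i)
    proj-isHomomorphism   : ∀ i → IsHomomorphism A (factor i) (proj i)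
    proj-surjective       : ∀ i → Surjective A._≈_ (ResiduatedLattice._≈_ (factor i)) (proj i)
    proj-jointlyInjective : ∀ x y →
      (∀ i → ResiduatedLattice._≈_ (factor i) (proj i x) (proj i y)) → x A.≈ y

infixr 6 _∨ᵗ_
infixr 7 _∧ᵗ_
infixl 8 _∙ᵗ_
infixr 8 _\\ᵗ_
infixl 8 _//ᵗ_

data Term : Set where
  var  : ℕ → Term
  _∧ᵗ_ _∨ᵗ_ _∙ᵗ_ _\\ᵗ_ _//ᵗ_ : Term → Term → Term
  εᵗ   : Term

module _ {c ℓ : Level} (A : ResiduatedLattice c ℓ) where
  open ResiduatedLattice A hiding (Carrier)

  eval : (ℕ → Carrier A) → Term → Carrier A
  eval ρ (var n)   = ρ n
  eval ρ (s ∧ᵗ t)  = eval ρ s ∧ eval ρ t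
  eval ρ (s ∨ᵗ t)  = eval ρ s ∨ eval ρ t
  eval ρ (s ∙ᵗ t)  = eval ρ s ∙ eval ρ t
  eval ρ (s \\ᵗ t) = eval ρ s \\ eval ρ t
  eval ρ (s //ᵗ t) = eval ρ s // eval ρ t
  eval ρ εᵗ        = ε

  Satisfies : Term → Term → Set (c ⊔ ℓ)
  Satisfies s t = ∀ ρ → eval ρ s ≈ eval ρ t

-- A variety is a class defined by equations, so the least variety containing K
-- is the class of models of all equations that are valid throughout K.
VarietyGeneratedBy : ∀ {c ℓ p} → (ResiduatedLattice c ℓ → Set p) →
                     ResiduatedLattice c ℓ → Set (suc (c ⊔ ℓ) ⊔ p)
VarietyGeneratedBy K A =
  ∀ s t → (∀ B → K B → Satisfies B s t) → Satisfies A s t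

Semilinear : ∀ {c ℓ} → ResiduatedLattice c ℓ → Set (suc (c ⊔ ℓ))
Semilinear = IsSubdirectProductOf TotallyOrdered

Semiconic : ∀ {c ℓ} → ResiduatedLattice c ℓ → Set (suc (c ⊔ ℓ))
Semiconic = VarietyGeneratedBy Conic

SemilinearIdempotent : ∀ c ℓ → ResiduatedLattice c ℓ → Set (suc (c ⊔ ℓ))
SemilinearIdempotent c ℓ A = Semilinear A × Idempotent A

SemiconicIdempotent : ∀ c ℓ → ResiduatedLattice c ℓ → Set (suc (c ⊔ ℓ))
SemiconicIdempotent c ℓ A = Semiconic A × Idempotent A

AmalgamationProperty : ∀ {c ℓ p} → (ResiduatedLattice c ℓ → Set p) → Set (suc (c ⊔ ℓ) ⊔ p)
AmalgamationProperty {c} {ℓ} K =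
  ∀ (A B C : ResiduatedLattice c ℓ) → K A → K B → K C →
  ∀ (fB : Carrier A → Carrier B) (fC : Carrier A → Carrier C) →
  IsEmbedding A B fB → IsEmbedding A C fC →
  Σ[ D ∈ ResiduatedLattice c ℓ ] K D ×
  (∃[ gB ] ∃[ gC ] IsEmbedding B D gB × IsEmbedding C D gC ×
    (∀ x → ResiduatedLattice._≈_ D ((gB ∘ fB) x) ((gC ∘ fC) x)))

{-# OPTIONS --safe #-}

-- Let C be the chain ⊥ < u < 1 < c < ⊤ with 1/u = c, u\1 = 1, 1/c = ⊥, c\1 = u,
-- let B be the chain ⊥ < b < 1 < d < ⊤ obtained from it by interchanging the
-- two inverses, and let A be their common subalgebra {⊥, 1, ⊤}.  In a conic
-- amalgam, ud ≤ 1 would give d ≤ u\1 = 1, so 1 ≤ ud; hence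
-- cd ≤ c(ud)d = (cu)(dd) = ud ≤ d and c ≤ d, and b = 1/d ≤ 1/c = ⊥, which is
-- absurd.  The case distinction on x = ud is the identity
-- (x\1 ∧ 1) ∨ (x ∧ 1) = 1, which holds in conic algebras and hence in
-- semiconic, in particular in semilinear, ones.
module Submission where

open import Defs
open import Algebra.Construct.NaturalChoice.Max using () renaming (maxOperator to naturalMax)
open import Algebra.Construct.NaturalChoice.Min using () renaming (minOperator to naturalMin)
open import Algebra.Construct.NaturalChoice.Base using (MinOperator; MaxOperator)
open import Algebra.Lattice.Bundles using (Lattice)
import Algebra.Lattice.Construct.NaturalChoice.MinMaxOp as MinMaxOp
import Algebra.Lattice.Morphism.Construct.Identity as LatticeIdentity
import Algebra.Lattice.Morphism.LatticeMonomorphism as LatticeMonomorphism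
open import Algebra.Lattice.Morphism.Structures using (module LatticeMorphisms)
import Algebra.Lattice.Properties.Lattice as LatticeProperties
open import Algebra.Lattice.Structures using (IsLattice)
import Algebra.Morphism.Construct.Identity as MonoidIdentity
open import Algebra.Morphism.Structures using (module MonoidMorphisms)
open import Algebra.Core using (Op₂)
open import Algebra.Structures using (IsMonoid)
open import Data.Bool.Base using (if_then_else_)
open import Data.Fin.Base using (Fin; toℕ)
open import Data.Fin.Patterns using (0F; 1F; 2F; 3F; 4F)
open import Data.Fin.Properties using (_≟_; _≤?_; all?; ≤-totalOrder)
open import Data.Nat.Base using (ℕ)
open import Data.Nat.Properties using (1+n≢0)
open import Data.Product.Base using (_×_; _,_; proj₁; proj₂)
open import Data.Sum.Base using (_⊎_; inj₁; inj₂)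
import Data.Sum.Base as Sum
open import Data.Unit.Polymorphic.Base using (⊤)
open import Data.Vec.Base using (Vec; lookup; []; _∷_)
open import Function.Base using (id; _∘_)
open import Function.Bundles using (mk⇔; Equivalence)
import Function.Construct.Identity as Identity
open import Level using (Level; Lift; lift; lower; 0ℓ)
open import Relation.Binary.Bundles using (Poset; TotalOrder)
import Relation.Binary.Lattice as Order
open import Relation.Binary.Core using (Rel)
open import Relation.Binary.PropositionalEquality
  using (_≡_; refl; sym; trans; cong; cong₂)
import Relation.Binary.Reasoning.PartialOrder as ≤-Reasoning
import Relation.Binary.Reasoning.Setoid as ≈-Reasoning
open import Relation.Nullary.Decidable using (Dec; does; from-yes; _×-dec_; _⊎-dec_; _→-dec_)
open import Relation.Nullary.Negation.Core using (¬_)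

private
  variable
    a b c ℓ ℓ₁ ℓ₂ p q : Level

open ResiduatedLattice using (Carrier)

-- Order, residuation and congruence in residuated lattices.

module ResiduatedLatticeProperties (D : ResiduatedLattice c ℓ) where
  open ResiduatedLattice D public
  open IsMonoid isMonoid public
    using (assoc; identityˡ; identityʳ; ∙-cong; setoid)
    renaming (refl to ≈-refl; sym to ≈-sym; trans to ≈-trans)
  open IsLattice isLattice public using (∧-cong; ∨-cong)

  lattice : Lattice c ℓ
  lattice = record { isLattice = isLattice }

  open LatticeProperties lattice public using (poset; ∨-∧-isOrderTheoreticLattice)
  open Order.IsLattice ∨-∧-isOrderTheoreticLattice public
    using (x∧y≤x; x∧y≤y; ∧-greatest; x≤x∨y; y≤x∨y; ∨-least; antisym)
  open Poset poset public using ()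
    renaming (refl to ≤-refl; reflexive to ≤-reflexive; trans to ≤-trans)

  to-\\ : ∀ {x y z} → x ∙ y ≤ z → y ≤ x \\ z
  to-\\ = Equivalence.from (\\-residual _ _ _)

  from-\\ : ∀ {x y z} → y ≤ x \\ z → x ∙ y ≤ z
  from-\\ = Equivalence.to (\\-residual _ _ _)

  to-// : ∀ {x y z} → x ∙ y ≤ z → x ≤ z // y
  to-// = Equivalence.to (//-residual _ _ _)

  from-// : ∀ {x y z} → x ≤ z // y → x ∙ y ≤ z
  from-// = Equivalence.from (//-residual _ _ _)

  ∙-monoˡ : ∀ {x y z} → x ≤ y → x ∙ z ≤ y ∙ z
  ∙-monoˡ x≤y = from-// (≤-trans x≤y (to-// ≤-refl))

  ∙-monoʳ : ∀ {x y z} → x ≤ y → z ∙ x ≤ z ∙ y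
  ∙-monoʳ x≤y = from-\\ (≤-trans x≤y (to-\\ ≤-refl))

  \\-cong : ∀ {x x′ z z′} → x ≈ x′ → z ≈ z′ → x \\ z ≈ x′ \\ z′
  \\-cong x≈x′ z≈z′ = antisym (half x≈x′ z≈z′) (half (≈-sym x≈x′) (≈-sym z≈z′))
    where
    half : ∀ {x x′ z z′} → x ≈ x′ → z ≈ z′ → x \\ z ≤ x′ \\ z′
    half x≈x′ z≈z′ = to-\\ (≤-trans (∙-monoˡ (≤-reflexive (≈-sym x≈x′)))
                     (≤-trans (from-\\ ≤-refl) (≤-reflexive z≈z′)))

  //-cong : ∀ {z z′ x x′} → z ≈ z′ → x ≈ x′ → z // x ≈ z′ // x′
  //-cong z≈z′ x≈x′ = antisym (half z≈z′ x≈x′) (half (≈-sym z≈z′) (≈-sym x≈x′))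
    where
    half : ∀ {z z′ x x′} → z ≈ z′ → x ≈ x′ → z // x ≤ z′ // x′
    half z≈z′ x≈x′ = to-// (≤-trans (∙-monoʳ (≤-reflexive (≈-sym x≈x′)))
                     (≤-trans (from-// ≤-refl) (≤-reflexive z≈z′)))

-- Homomorphisms: transport of inequalities and of term values.

module HomomorphismProperties
  {A : ResiduatedLattice a ℓ₁} {B : ResiduatedLattice b ℓ₂} {f : Carrier A → Carrier B}
  (isHomomorphism : IsHomomorphism A B f) where
  private
    module A = ResiduatedLatticeProperties A
    module B = ResiduatedLatticeProperties B
  open IsHomomorphism isHomomorphism public
  open LatticeMorphisms A.rawLattice B.rawLattice using (IsLatticeHomomorphism)
  open MonoidMorphisms A.rawMonoid B.rawMonoid using (IsMonoidHomomorphism)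
  open IsLatticeHomomorphism isLatticeHomomorphism public using (⟦⟧-cong; ∧-homo; ∨-homo)
  open IsMonoidHomomorphism isMonoidHomomorphism public
    using (ε-homo) renaming (homo to ∙-homo)

  mono : ∀ {x y} → x A.≤ y → f x B.≤ f y
  mono x≤y = B.≈-trans (⟦⟧-cong x≤y) (∧-homo _ _)

  -- This and the two lemmas that follow carry an inequality found by evaluation in a finite chain
  -- over to the images in an amalgam.
  ∙-mono : ∀ {x y z} → x A.∙ y A.≤ z → f x B.∙ f y B.≤ f z
  ∙-mono xy≤z = B.≤-trans (B.≤-reflexive (B.≈-sym (∙-homo _ _))) (mono xy≤z)

  \\ε-mono : ∀ {x z} → x A.\\ A.ε A.≤ z → f x B.\\ B.ε B.≤ f z
  \\ε-mono x\1≤z = B.≤-trans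
    (B.≤-reflexive (B.≈-trans (B.\\-cong B.≈-refl (B.≈-sym ε-homo)) (B.≈-sym (\\-homo _ _))))
    (mono x\1≤z)

  ε//-mono : ∀ {x z} → A.ε A.// x A.≤ z → B.ε B.// f x B.≤ f z
  ε//-mono 1/x≤z = B.≤-trans
    (B.≤-reflexive (B.≈-trans (B.//-cong (B.≈-sym ε-homo) B.≈-refl) (B.≈-sym (//-homo _ _))))
    (mono 1/x≤z)

  eval-homo : ∀ ρ t → f (eval A ρ t) B.≈ eval B (f ∘ ρ) t
  eval-homo ρ (var n)   = B.≈-refl
  eval-homo ρ (s ∧ᵗ t)  = B.≈-trans (∧-homo _ _) (B.∧-cong (eval-homo ρ s) (eval-homo ρ t))
  eval-homo ρ (s ∨ᵗ t)  = B.≈-trans (∨-homo _ _) (B.∨-cong (eval-homo ρ s) (eval-homo ρ t))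
  eval-homo ρ (s ∙ᵗ t)  = B.≈-trans (∙-homo _ _) (B.∙-cong (eval-homo ρ s) (eval-homo ρ t))
  eval-homo ρ (s \\ᵗ t) = B.≈-trans (\\-homo _ _) (B.\\-cong (eval-homo ρ s) (eval-homo ρ t))
  eval-homo ρ (s //ᵗ t) = B.≈-trans (//-homo _ _) (B.//-cong (eval-homo ρ s) (eval-homo ρ t))
  eval-homo ρ εᵗ        = ε-homo

-- Subdirect products and generated varieties.

module _ {K : ResiduatedLattice c ℓ → Set p} {L : ResiduatedLattice c ℓ → Set q} where

  -- Joint injectivity reduces an equation to the factors, where `eval-homo` makes it an instance at
  -- the projected valuation.
  subdirectProduct⇒variety : (∀ {B} → K B → L B) →
    ∀ {A} → IsSubdirectProductOf K A → VarietyGeneratedBy L A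
  subdirectProduct⇒variety K⇒L {A} A-subdirect s t L⊨s≈t ρ =
    proj-jointlyInjective _ _ λ i →
      let open ResiduatedLatticeProperties (factor i)
          open HomomorphismProperties (proj-isHomomorphism i)
          open ≈-Reasoning setoid
      in begin
        proj i (eval A ρ s)            ≈⟨ eval-homo ρ s ⟩
        eval (factor i) (proj i ∘ ρ) s ≈⟨ L⊨s≈t (factor i) (K⇒L (inK i)) (proj i ∘ ρ) ⟩
        eval (factor i) (proj i ∘ ρ) t ≈⟨ eval-homo ρ t ⟨
        proj i (eval A ρ t)            ∎
    where open IsSubdirectProductOf A-subdirect

module _ {K : ResiduatedLattice c ℓ → Set p} where

  -- The algebra is its own single factor; this makes the finite chains semilinear.
  factor⇒subdirectProduct : ∀ {A} → K A → IsSubdirectProductOf K A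
  factor⇒subdirectProduct {A} A∈K = record
    { Index  = ⊤
    ; factor = λ _ → A
    ; inK    = λ _ → A∈K
    ; proj   = λ _ → id
    ; proj-isHomomorphism = λ _ → record
      { isLatticeHomomorphism = LatticeIdentity.isLatticeHomomorphism rawLattice ≈-refl
      ; isMonoidHomomorphism  = MonoidIdentity.isMonoidHomomorphism rawMonoid ≈-refl
      ; \\-homo               = λ _ _ → ≈-refl
      ; //-homo               = λ _ _ → ≈-refl
      }
    ; proj-surjective       = λ _ → Identity.surjective _≈_
    ; proj-jointlyInjective = λ _ _ x≈y → x≈y _
    }
    where open ResiduatedLatticeProperties A

-- A chain is conic, since each element is comparable with `ε`. Thus one refutation serves both
-- classes.
semilinear⇒semiconic : ∀ {A : ResiduatedLattice c ℓ} → Semilinear A → Semiconic A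
semilinear⇒semiconic = subdirectProduct⇒variety λ {B} total x → total x (ResiduatedLattice.ε B)

-- An identity of semiconic algebras and the inequality drawn from it.

conicityTerm : Term
conicityTerm = (var 0 \\ᵗ εᵗ ∧ᵗ εᵗ) ∨ᵗ (var 0 ∧ᵗ εᵗ)

-- If x ≤ 1, then 1 lies below the right inverse of x and the first joinand is 1; if 1 ≤ x, the
-- second one is.
conic⇒conicityTerm : ∀ (B : ResiduatedLattice c ℓ) → Conic B → Satisfies B conicityTerm εᵗ
conic⇒conicityTerm B conic ρ = antisym (∨-least (x∧y≤y _ _) (x∧y≤y _ _)) (ε≤ (conic (ρ 0)))
  where
  open ResiduatedLatticeProperties B
  ε≤ : (ρ 0 ≤ ε) ⊎ (ε ≤ ρ 0) → ε ≤ eval B ρ conicityTerm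
  ε≤ (inj₁ x≤ε) = ≤-trans
    (∧-greatest (to-\\ (≤-trans (≤-reflexive (identityʳ _)) x≤ε)) ≤-refl) (x≤x∨y _ _)
  ε≤ (inj₂ ε≤x) = ≤-trans (∧-greatest ε≤x ≤-refl) (y≤x∨y _ _)

module _ (D : ResiduatedLattice c ℓ) (D-semiconic : Semiconic D) where
  open ResiduatedLatticeProperties D

  semiconic-conicity : ∀ x → ε ≤ (x \\ ε ∧ ε) ∨ (x ∧ ε)
  semiconic-conicity x =
    -- Only `var 0` occurs in the term, so a constant valuation suffices.
    ≤-reflexive (≈-sym (D-semiconic conicityTerm εᵗ conic⇒conicityTerm (λ _ → x)))

  -- Here `z` stands for the common image of ⊥. That image need not be least in `D`, so the facts
  -- about ⊥ that the argument uses are stated as inequalities, which embeddings preserve.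
  semiconic-bound : ∀ {z u c d} → u \\ ε ≤ ε → c ∙ u ≤ u → u ≤ ε → d \\ ε ≤ z →
                    d ∙ d ≤ d → ε ≤ d → c ∙ z ≤ z → z ∙ d ≤ d → c ≤ d
  semiconic-bound {z} {u} {c} {d} u\1≤1 cu≤u u≤1 d\1≤z dd≤d 1≤d cz≤z zd≤d = begin
    c      ≈⟨ identityʳ c ⟨
    c ∙ ε  ≤⟨ ∙-monoʳ 1≤d ⟩
    c ∙ d  ≤⟨ from-// (≤-trans (≤-reflexive (≈-sym (identityʳ c))) (from-\\ 1≤)) ⟩
    d      ∎
    where
    open ≤-Reasoning poset

    ud = u ∙ d

    ud\1≤z : ud \\ ε ≤ z
    ud\1≤z = ≤-trans (to-\\ (≤-trans (to-\\ (begin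
      -- Let w be the right inverse of `ud`. Since u(dw) ≤ 1, the product dw lies below the right
      -- inverse of `u`, hence below 1, and so w lies below the right inverse of `d`.
      u ∙ (d ∙ (ud \\ ε))  ≈⟨ assoc _ _ _ ⟨
      ud ∙ (ud \\ ε)       ≤⟨ from-\\ ≤-refl ⟩
      ε                    ∎)) u\1≤1)) d\1≤z

    c∙z∙d≤d : c ∙ z ∙ d ≤ d
    c∙z∙d≤d = ≤-trans (∙-monoˡ cz≤z) zd≤d

    c∙ud∙d≤d : c ∙ ud ∙ d ≤ d
    c∙ud∙d≤d = begin
      c ∙ (u ∙ d) ∙ d  ≈⟨ ∙-cong (assoc _ _ _) ≈-refl ⟨
      c ∙ u ∙ d ∙ d    ≈⟨ assoc _ _ _ ⟩
      c ∙ u ∙ (d ∙ d)  ≤⟨ ∙-monoˡ cu≤u ⟩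
      u ∙ (d ∙ d)      ≤⟨ ∙-monoʳ dd≤d ⟩
      u ∙ d            ≤⟨ ∙-monoˡ u≤1 ⟩
      ε ∙ d            ≈⟨ identityˡ d ⟩
      d                ∎

    -- The bound is the largest x with cxd ≤ d, so it lies above a join as soon as it lies above
    -- both joinands. For x = 1 this yields cd ≤ d.
    1≤ : ε ≤ c \\ (d // d)
    1≤ = ≤-trans (semiconic-conicity ud) (∨-least
      (≤-trans (≤-trans (x∧y≤x _ _) ud\1≤z) (to-\\ (to-// c∙z∙d≤d)))
      (≤-trans (x∧y≤x _ _) (to-\\ (to-// c∙ud∙d≤d))))

-- Finite idempotent chains given by tables of inverses.

-- In an idempotent residuated chain xy = x ∧ y if xy ≤ 1 and xy = x ∨ y
-- otherwise, so the order and the inverses x ˡ = 1/x and x ʳ = x\1 determine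
-- all operations.
record InverseTable (n : ℕ) : Set where
  field
    unit : Fin n
    _ˡ   : Fin n → Fin n
    _ʳ   : Fin n → Fin n

  order : TotalOrder 0ℓ 0ℓ 0ℓ
  order = ≤-totalOrder n

  open MinOperator (naturalMin order) public using (_⊓_)
  open MaxOperator (naturalMax order) public using (_⊔_)
  open MinMaxOp (naturalMin order) (naturalMax order) public using (⊔-⊓-isLattice)

  -- The residuals come from the product: xy is the meet if y lies below `x ʳ`, and the join
  -- otherwise. If x ≤ z, then xy ≤ z holds iff y lies below `x ʳ` or below z; if z < x, iff y lies
  -- below both. The other residual is dual.
  _·_ _⇒_ _⇐_ : Fin n → Fin n → Fin n
  x · y = if does (x ≤? y ˡ) then x ⊓ y else x ⊔ y
  x ⇒ z = if does (x ≤? z) then x ʳ ⊔ z else x ʳ ⊓ z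
  z ⇐ x = if does (x ≤? z) then x ˡ ⊔ z else x ˡ ⊓ z

  infix 4 _≼_
  -- In this form the relation agrees definitionally, up to `Lift`, with the order of the residuated
  -- lattice built below, so the laws carry over unchanged.
  _≼_ : Fin n → Fin n → Set
  x ≼ y = x ≡ x ⊓ y

  -- All quantifiers range over `Fin n`, so a concrete table is verified by evaluating `laws?`.
  Laws : Set
  Laws = (∀ x → unit · x ≡ x × x · unit ≡ x × x · x ≡ x) ×
         (∀ x y → x ≼ y ⊎ y ≼ x) ×
         (∀ x y z → (x · y) · z ≡ x · (y · z)) ×
         (∀ x y z → (y ≼ x ⇒ z → x · y ≼ z) × (x · y ≼ z → y ≼ x ⇒ z) ×
                    (x · y ≼ z → x ≼ z ⇐ y) × (x ≼ z ⇐ y → x · y ≼ z))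

  laws? : Dec Laws
  laws? =
    all? (λ x → unit · x ≟ x ×-dec x · unit ≟ x ×-dec x · x ≟ x) ×-dec
    all? (λ x → all? λ y → (x ≼? y) ⊎-dec (y ≼? x)) ×-dec
    all? (λ x → all? λ y → all? λ z → (x · y) · z ≟ x · (y · z)) ×-dec
    all? (λ x → all? λ y → all? λ z →
      ((y ≼? x ⇒ z) →-dec (x · y ≼? z)) ×-dec ((x · y ≼? z) →-dec (y ≼? x ⇒ z)) ×-dec
      ((x · y ≼? z) →-dec (x ≼? z ⇐ y)) ×-dec ((x ≼? z ⇐ y) →-dec (x · y ≼? z)))
    where
    infix 4 _≼?_
    _≼?_ : ∀ x y → Dec (x ≼ y)
    x ≼? y = x ≟ x ⊓ y

module Chain {n : ℕ} (T : InverseTable n) (laws : InverseTable.Laws T) (c ℓ : Level) where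
  open InverseTable T

  private
    _≈_ : Rel (Lift c (Fin n)) ℓ
    x ≈ y = Lift ℓ (lower x ≡ lower y)

    lift₂ : Op₂ (Fin n) → Op₂ (Lift c (Fin n))
    lift₂ _◦_ x y = lift (lower x ◦ lower y)

  -- Lifting carrier and equality places the same finite chain at arbitrary universe levels.
  residuatedLattice : ResiduatedLattice c ℓ
  residuatedLattice = record
    { _≈_ = _≈_
    ; _∧_ = lift₂ _⊓_
    ; _∨_ = lift₂ _⊔_
    ; _∙_ = lift₂ _·_
    ; _\\_ = lift₂ _⇒_
    ; _//_ = lift₂ _⇐_
    ; ε = lift unit
    ; isLattice = LatticeMonomorphism.isLattice {⟦_⟧ = lower} (record
      { isLatticeHomomorphism = record
        { isRelHomomorphism = record { cong = lower }
        ; ∧-homo = λ _ _ → refl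
        ; ∨-homo = λ _ _ → refl
        }
      ; injective = lift
      }) ⊔-⊓-isLattice
    ; isMonoid = record
      { isSemigroup = record
        { isMagma = record
          { isEquivalence = record
            { refl  = lift refl
            ; sym   = λ p → lift (sym (lower p))
            ; trans = λ p q → lift (trans (lower p) (lower q))
            }
          ; ∙-cong = λ p q → lift (cong₂ _·_ (lower p) (lower q))
          }
        ; assoc = λ x y z → lift (assoc (lower x) (lower y) (lower z))
        }
      ; identity = (λ x → lift (proj₁ (unital (lower x)))) ,
                   (λ x → lift (proj₁ (proj₂ (unital (lower x)))))
      }
    ; \\-residual = λ x y z →
        let to , from , _ = residual (lower x) (lower y) (lower z)
        in mk⇔ (lift ∘ to ∘ lower) (lift ∘ from ∘ lower)
    ; //-residual = λ x y z →
        let _ , _ , to , from = residual (lower x) (lower y) (lower z)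
        in mk⇔ (lift ∘ to ∘ lower) (lift ∘ from ∘ lower)
    }
    where
    unital   = proj₁ laws
    assoc    = proj₁ (proj₂ (proj₂ laws))
    residual = proj₂ (proj₂ (proj₂ laws))

  semilinearIdempotent : SemilinearIdempotent c ℓ residuatedLattice
  semilinearIdempotent =
    factor⇒subdirectProduct (λ x y →
      Sum.map lift lift (proj₁ (proj₂ laws) (lower x) (lower y))) ,
    λ x → lift (proj₂ (proj₂ (proj₁ laws (lower x))))

-- Embeddings between finite chains.

module _ {m n : ℕ} (S : InverseTable m) (T : InverseTable n) where
  private
    module S = InverseTable S
    module T = InverseTable T

  Embeds : (Fin m → Fin n) → Set
  Embeds f =
    f S.unit ≡ T.unit ×
    (∀ x y → (f x ≡ f y → x ≡ y) ×
             f (x S.⊓ y) ≡ f x T.⊓ f y × f (x S.⊔ y) ≡ f x T.⊔ f y ×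
             f (x S.· y) ≡ f x T.· f y ×
             f (x S.⇒ y) ≡ f x T.⇒ f y × f (x S.⇐ y) ≡ f x T.⇐ f y)

  embeds? : ∀ f → Dec (Embeds f)
  embeds? f =
    f S.unit ≟ T.unit ×-dec
    all? λ x → all? λ y → (f x ≟ f y →-dec x ≟ y) ×-dec
      f (x S.⊓ y) ≟ f x T.⊓ f y ×-dec f (x S.⊔ y) ≟ f x T.⊔ f y ×-dec
      f (x S.· y) ≟ f x T.· f y ×-dec
      f (x S.⇒ y) ≟ f x T.⇒ f y ×-dec f (x S.⇐ y) ≟ f x T.⇐ f y

  embedding : ∀ S-laws T-laws {f} → Embeds f →
    IsEmbedding (Chain.residuatedLattice S S-laws c ℓ) (Chain.residuatedLattice T T-laws c ℓ)
                (λ x → lift (f (lower x)))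
  embedding _ _ {f} (f-unit , f-ops) = record
    { isHomomorphism = record
      { isLatticeHomomorphism = record
        { isRelHomomorphism = isRelHomomorphism
        ; ∧-homo = λ x y → let _ , ⊓-homo , _ = ops x y in lift ⊓-homo
        ; ∨-homo = λ x y → let _ , _ , ⊔-homo , _ = ops x y in lift ⊔-homo
        }
      ; isMonoidHomomorphism = record
        { isMagmaHomomorphism = record
          { isRelHomomorphism = isRelHomomorphism
          ; homo = λ x y → let _ , _ , _ , ·-homo , _ = ops x y in lift ·-homo
          }
        ; ε-homo = lift f-unit
        }
      ; \\-homo = λ x y → let _ , _ , _ , _ , ⇒-homo , _ = ops x y in lift ⇒-homo
      ; //-homo = λ x y → let _ , _ , _ , _ , _ , ⇐-homo = ops x y in lift ⇐-homo
      }
    ; injective = λ {x} {y} p → lift (proj₁ (ops x y) (lower p))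
    }
    where
    ops = λ x y → f-ops (lower x) (lower y)
    isRelHomomorphism = record { cong = λ p → lift (cong f (lower p)) }

-- The three chains and the two inclusions.

tableA : InverseTable 3
tableA = record
  { unit = 1F
  ; _ˡ   = lookup (2F ∷ 1F ∷ 0F ∷ [])
  ; _ʳ   = lookup (2F ∷ 1F ∷ 0F ∷ [])
  }

-- The elements ⊥, b, 1, d, ⊤ in this order.
tableB : InverseTable 5
tableB = record
  { unit = 2F
  ; _ˡ   = lookup (4F ∷ 2F ∷ 2F ∷ 1F ∷ 0F ∷ [])
  ; _ʳ   = lookup (4F ∷ 3F ∷ 2F ∷ 0F ∷ 0F ∷ [])
  }

-- The elements ⊥, u, 1, c, ⊤ in this order.
tableC : InverseTable 5
tableC = record
  { unit = 2F
  ; _ˡ   = InverseTable._ʳ tableB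
  ; _ʳ   = InverseTable._ˡ tableB
  }

-- The elements ⊥, 1, ⊤ have indices 0, 2, 4 in both larger chains. The left and right inverses
-- agree on them, so interchanging the inverses leaves this subalgebra unchanged.
bounds : Fin 3 → Fin 5
bounds = lookup (0F ∷ 2F ∷ 4F ∷ [])

lawsA : InverseTable.Laws tableA
lawsA = from-yes (InverseTable.laws? tableA)

lawsB : InverseTable.Laws tableB
lawsB = from-yes (InverseTable.laws? tableB)

lawsC : InverseTable.Laws tableC
lawsC = from-yes (InverseTable.laws? tableC)

A B C : ∀ c ℓ → ResiduatedLattice c ℓ
A = Chain.residuatedLattice tableA lawsA
B = Chain.residuatedLattice tableB lawsB
C = Chain.residuatedLattice tableC lawsC

A↪B : IsEmbedding (A c ℓ) (B c ℓ) (lift ∘ bounds ∘ lower)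
A↪B = embedding tableA tableB lawsA lawsB (from-yes (embeds? tableA tableB bounds))

A↪C : IsEmbedding (A c ℓ) (C c ℓ) (lift ∘ bounds ∘ lower)
A↪C = embedding tableA tableC lawsA lawsC (from-yes (embeds? tableA tableC bounds))

-- Failure of amalgamation.

no-semiconic-amalgam : ∀ {D : ResiduatedLattice a ℓ₁} → Semiconic D → ∀ {gB gC} →
  IsEmbedding (B c ℓ) D gB → IsEmbedding (C c ℓ) D gC →
  ¬ (∀ (x : Carrier (A c ℓ)) → ResiduatedLattice._≈_ D
       (gB (lift (bounds (lower x)))) (gC (lift (bounds (lower x)))))
no-semiconic-amalgam {D = D} D-semiconic {gB} {gC} gB-embedding gC-embedding agree =
  -- Injectivity of `gB` would identify the indices 1 and 0 of b and ⊥.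
  1+n≢0 (cong toℕ (lower (injective b≈⊥)))
  where
  open ResiduatedLatticeProperties D
  open IsEmbedding gB-embedding using (injective)
  open ≤-Reasoning poset
  module gB = HomomorphismProperties (IsEmbedding.isHomomorphism gB-embedding)
  module gC = HomomorphismProperties (IsEmbedding.isHomomorphism gC-embedding)

  ⊥-agree : gC (lift 0F) ≈ gB (lift 0F)
  ⊥-agree = ≈-sym (agree (lift 0F))

  gC-c≤gB-d : gC (lift 3F) ≤ gB (lift 3F)
  -- Each hypothesis is an inequality of one chain, true by computation. Only c⊥ ≤ ⊥ mixes the two
  -- images, and there the agreement on ⊥ enters.
  gC-c≤gB-d = semiconic-bound D D-semiconic {z = gB (lift 0F)} {u = gC (lift 1F)}
    (≤-trans (gC.\\ε-mono {z = lift 2F} (lift refl)) (≤-reflexive gC.ε-homo))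
    (gC.∙-mono (lift refl))
    (≤-trans (gC.mono {y = lift 2F} (lift refl)) (≤-reflexive gC.ε-homo))
    (gB.\\ε-mono (lift refl))
    (gB.∙-mono (lift refl))
    (≤-trans (≤-reflexive (≈-sym gB.ε-homo)) (gB.mono {x = lift 2F} (lift refl)))
    (begin
      gC (lift 3F) ∙ gB (lift 0F)  ≈⟨ ∙-cong ≈-refl ⊥-agree ⟨
      gC (lift 3F) ∙ gC (lift 0F)  ≤⟨ gC.∙-mono (lift refl) ⟩
      gC (lift 0F)                 ≈⟨ ⊥-agree ⟩
      gB (lift 0F)                 ∎)
    (gB.∙-mono (lift refl))

  b≤⊥ : gB (lift 1F) ≤ gB (lift 0F)
  b≤⊥ = begin
    -- Since c ≤ d, the inequality bd ≤ 1 of `B` gives bc ≤ 1, while `C` makes the left inverse of c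
    -- equal to ⊥.
    gB (lift 1F)       ≤⟨ to-// (begin
      gB (lift 1F) ∙ gC (lift 3F)  ≤⟨ ∙-monoʳ gC-c≤gB-d ⟩
      gB (lift 1F) ∙ gB (lift 3F)  ≤⟨ gB.∙-mono {z = lift 2F} (lift refl) ⟩
      gB (lift 2F)                 ≈⟨ gB.ε-homo ⟩
      ε                            ∎) ⟩
    ε // gC (lift 3F)  ≤⟨ gC.ε//-mono (lift refl) ⟩
    gC (lift 0F)       ≈⟨ ⊥-agree ⟩
    gB (lift 0F)       ∎

  b≈⊥ : gB (lift 1F) ≈ gB (lift 0F)
  b≈⊥ = antisym b≤⊥ (gB.mono (lift refl))

-- The same three chains refute amalgamation in every class between the semilinear idempotent and
-- the semiconic algebras; both classes of the theorem lie in this interval.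
amalgamation-fails : ∀ {K : ResiduatedLattice c ℓ → Set p} →
  (∀ D → K D → Semiconic D) → (∀ D → SemilinearIdempotent c ℓ D → K D) →
  ¬ AmalgamationProperty K
amalgamation-fails {c} {ℓ} K⇒semiconic semilinearIdempotent⇒K AP =
  let D , D∈K , _ , _ , B↪D , C↪D , agree =
        AP (A c ℓ) (B c ℓ) (C c ℓ)
           (semilinearIdempotent⇒K (A c ℓ) (Chain.semilinearIdempotent tableA lawsA c ℓ))
           (semilinearIdempotent⇒K (B c ℓ) (Chain.semilinearIdempotent tableB lawsB c ℓ))
           (semilinearIdempotent⇒K (C c ℓ) (Chain.semilinearIdempotent tableC lawsC c ℓ))
           (lift ∘ bounds ∘ lower) (lift ∘ bounds ∘ lower) A↪B A↪C
  in no-semiconic-amalgam {D = D} (K⇒semiconic D D∈K) B↪D C↪D agree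

corollary5p3 : ∀ c ℓ →
    (¬ AmalgamationProperty (SemilinearIdempotent c ℓ)) ×
    (¬ AmalgamationProperty (SemiconicIdempotent c ℓ))
corollary5p3 c ℓ =
  amalgamation-fails (λ D (semilinear , _) → semilinear⇒semiconic {A = D} semilinear)
                     (λ _ → id) ,
  amalgamation-fails (λ _ → proj₁)
                     (λ D (semilinear , idempotent) →
                       semilinear⇒semiconic {A = D} semilinear , idempotent)
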